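{- Let $p$ be a prime and let $c:\mathbb{Z}\to\{B,R\}$ be a periodic coloring such that for every positive integer $d$ with $p\nmid d$ and every $a\in\mathbb{Z}$, the values $c(a),c(a+d),c(a+2d),c(a+3d)$ are not all equal. Then every period $T\ge1$ of $c$ (i.e. every $T$ with $c(n+T)=c(n)$ for all $n$) satisfies $T\ge p$. -}

module Defs where

open import Data.Nat using (ℕ; _≥_)
open import Data.Nat.Divisibility using (_∣_)
open import Data.Integer using (ℤ; +_; _+_; _*_)
open import Data.Product using (∃; _×_)
open import Relation.Nullary using (¬_)
open import Relation.Binary.PropositionalEquality using (_≡_)

data Color : Set where
  B R : Color

Coloring : Set
Coloring = ℤ → Color

-- Not necessarily the least period.
IsPeriod : Coloring → ℕ → Set
IsPeriod c T = T ≥ 1 × (∀ n → c (n + + T) ≡ c n)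

Periodic : Coloring → Set
Periodic c = ∃ λ T → IsPeriod c T

Monochromatic4AP : Coloring → ℤ → ℕ → Set
Monochromatic4AP c a d =
  c a ≡ c (a + + d) ×
  c a ≡ c (a + + 2 * + d) ×
  c a ≡ c (a + + 3 * + d)

AvoidsMonochromatic4APs : ℕ → Coloring → Set
AvoidsMonochromatic4APs p c =
  ∀ (d : ℕ) → d ≥ 1 → ¬ (p ∣ d) → ∀ (a : ℤ) → ¬ Monochromatic4AP c a d

{-# OPTIONS --safe #-}
module Submission where

open import Data.Nat using (ℕ; zero; suc; _≥_; >-nonZero)
open import Data.Nat.Properties using (≮⇒≥)
open import Data.Nat.Divisibility using (>⇒∤)
open import Data.Nat.Primality using (Prime)
open import Data.Integer using (+_; _+_; _*_; 0ℤ)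
open import Data.Integer.Properties using (+-identityʳ; +-assoc; *-zeroˡ; suc-*)
open import Data.Product using (_,_)
open import Relation.Binary.PropositionalEquality using (_≡_; cong; sym; trans; module ≡-Reasoning)
open import Defs

-- Moving by multiples of a period `T` never changes the colour, so any progression with difference
-- `T` is monochromatic. Avoidance therefore rules out `T` as a difference prime to `p`, whereas
-- every positive `T` below `p` is one.

period-multiple : ∀ {c T} → IsPeriod c T → ∀ k a → c (a + + k * + T) ≡ c a
period-multiple {c} {T} _ zero a =
  cong c (trans (cong (λ m → a + m) (*-zeroˡ (+ T))) (+-identityʳ a))
period-multiple {c} {T} period@(_ , shift) (suc k) a = begin
  c (a + + suc k * + T)      ≡⟨ cong (λ m → c (a + m)) (suc-* (+ k) (+ T)) ⟩
  c (a + (+ T + + k * + T))  ≡⟨ cong c (+-assoc a (+ T) (+ k * + T)) ⟨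
  -- `suc-*` puts the new `T` in front, so the induction hypothesis is used at the shifted base
  -- point.
  c (a + + T + + k * + T)    ≡⟨ period-multiple period k (a + + T) ⟩
  c (a + + T)                ≡⟨ shift a ⟩
  c a                        ∎
  where open ≡-Reasoning

period⇒Monochromatic4AP : ∀ {c T} → IsPeriod c T → ∀ a → Monochromatic4AP c a T
period⇒Monochromatic4AP period@(_ , shift) a =
  sym (shift a) , sym (period-multiple period 2 a) , sym (period-multiple period 3 a)

-- A period T < p would itself be an admissible common difference.
theorem6 : ∀ (p : ℕ) → Prime p → ∀ (c : Coloring) → Periodic c →
    AvoidsMonochromatic4APs p c → ∀ (T : ℕ) → IsPeriod c T → T ≥ p
theorem6 p _ c _ avoids T period@(T≥1 , _) = ≮⇒≥ λ T<p →
  -- Non-divisibility also needs `T≥1`, since `p` divides 0; the starting point `0ℤ` is arbitrary.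
  avoids T T≥1 (>⇒∤ {{>-nonZero T≥1}} T<p) 0ℤ (period⇒Monochromatic4AP period 0ℤ)
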